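{- For $n\ge 0$, $$(\mathfrak C_0+\mathfrak C_2)^n=(2n)!\sum_{l=0}^{n+1}\frac{(-1)^{n-l-1}(2l-1)(3n^2-3nl+2l^2+4n-3l+1)(2n-2l-1)!!}{3\cdot 2^{n-l}(n-l+1)!\,(2l)!}\mathfrak C_{2l}.$$
   Context: The numbers $\mathfrak C_{2n}$ (Cauchy numbers with level $2$) are defined by $\frac{t}{{\rm arcsinh}\,t}=\sum_{n=0}^\infty\mathfrak C_{2n}\frac{t^{2n}}{(2n)!}$. Convolution notation: $(\mathfrak C_{2j_1}+\cdots+\mathfrak C_{2j_k})^n:=\sum_{i_1+\cdots+i_k=n,\ i_1,\dots,i_k\ge0}\frac{(2n)!}{(2i_1)!\cdots(2i_k)!}\mathfrak C_{2i_1+2j_1}\cdots\mathfrak C_{2i_k+2j_k}$. Double factorials: $(2i-1)!!=(2i-1)(2i-3)\cdots1$ for $i\ge1$, $(-1)!!=1$, and $(-(2i+1))!!=\frac{(-1)^i}{(2i-1)!!}$ for $i\ge1$. -}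

module Defs where

open import Data.Fin.Base using (Fin; zero; suc; toℕ)
open import Data.Integer.Base as ℤ using (ℤ; +_; -[1+_]; -1ℤ)
open import Data.Nat.Base as ℕ using (ℕ; zero; suc; _!; _∸_)
open import Data.Nat.Properties using (_!≢0; m^n≢0; m*n≢0)
open import Data.Rational.Base
  using (ℚ; 0ℚ; 1ℚ; _+_; _*_; -_; _/_; 1/_; _÷_; Positive; NonZero; toℚᵘ)
open import Data.Rational.Properties
  using ( +-*-commutativeRing; +-identityˡ; +-identityʳ; +-inverseˡ; *-identityˡ
        ; *-identityʳ; *-zeroˡ; *-zeroʳ; *-assoc; pos*pos⇒pos; pos⇒nonZero
        ; normalize-pos; toℚᵘ-injective; toℚᵘ-homo-*; toℚᵘ-fromℚᵘ)
import Data.Rational.Unnormalised.Base as ℚᵘ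
import Data.Rational.Unnormalised.Properties as ℚᵘ
open import Algebra.Bundles using (CommutativeRing)
open import Data.Vec.Base using (Vec; []; _∷_; head; lookup; foldr′; zipWith)
open import Function.Base using (_∘_)
open import Relation.Binary.PropositionalEquality
  using (_≡_; refl; sym; trans; cong; cong₂; module ≡-Reasoning)

open CommutativeRing +-*-commutativeRing using (semiring)
open import Algebra.Properties.Semiring.Sum semiring public
open import Algebra.Properties.Semiring.Exp semiring public using (_^_)

fromℤ : ℤ → ℚ
fromℤ z = z / 1

fromℕ : ℕ → ℚ
fromℕ n = fromℤ (+ n)

infixr 8 _^ᶻ_

_^ᶻ_ : (p : ℚ) → ℤ → .{{NonZero p}} → ℚ
p ^ᶻ (+ k)    = p ^ k
p ^ᶻ -[1+ k ] = (1/ p) ^ suc k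

oddDoubleFactorial : ℕ → ℕ
oddDoubleFactorial zero    = 1
oddDoubleFactorial (suc i) = suc (2 ℕ.* i) ℕ.* oddDoubleFactorial i

oddDoubleFactorial≢0 : ∀ i → ℕ.NonZero (oddDoubleFactorial i)
oddDoubleFactorial≢0 zero    = _
oddDoubleFactorial≢0 (suc i) = m*n≢0 (suc (2 ℕ.* i)) _ {{_}} {{oddDoubleFactorial≢0 i}}

-- The double factorial (2z - 1)!! of an odd integer.  The negative case is
-- (-(2k + 1))!! = (-1)ᵏ / (2k - 1)!! with k = suc i.
[2_-1]!! : ℤ → ℚ
[2 + i -1]!!      = fromℕ (oddDoubleFactorial i)
[2 -[1+ i ] -1]!! =
  _/_ (-1ℤ ℤ.^ suc i) (oddDoubleFactorial (suc i)) {{oddDoubleFactorial≢0 (suc i)}}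

Series : Set
Series = ℕ → ℚ

infixl 7 _⊛_

_⊛_ : Series → Series → Series
(f ⊛ g) n = ∑[ i ≤ n ] (f (toℕ i) * g (n ∸ toℕ i))

t·_ : Series → Series
(t· f) zero    = 0ℚ
(t· f) (suc n) = f n

-- f(t) ↦ f(t²)
_[t²] : Series → Series
(f [t²]) zero          = f zero
(f [t²]) (suc zero)    = 0ℚ
(f [t²]) (suc (suc n)) = ((f ∘ suc) [t²]) n

one : Series
one zero    = 1ℚ
one (suc _) = 0ℚ

t : Series
t = t· one

arcsinhDenominator : ℕ → ℕ
arcsinhDenominator k = 4 ℕ.^ k ℕ.* (k ! ℕ.* k !) ℕ.* suc (2 ℕ.* k)

arcsinhDenominator≢0 : ∀ k → ℕ.NonZero (arcsinhDenominator k)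
arcsinhDenominator≢0 k =
  m*n≢0 _ _ {{m*n≢0 _ _ {{m^n≢0 4 k}} {{m*n≢0 _ _ {{k !≢0}} {{k !≢0}}}}}}

arcsinhCoeff : ℕ → ℚ
arcsinhCoeff k =
  _/_ (-1ℤ ℤ.^ k ℤ.* + ((2 ℕ.* k) !)) (arcsinhDenominator k) {{arcsinhDenominator≢0 k}}

-- The Maclaurin series Σₖ (-1)ᵏ (2k)! / (4ᵏ (k!)² (2k + 1)) · t²ᵏ⁺¹
arcsinh : Series
arcsinh = t· (arcsinhCoeff [t²])

-- Σₙ aₙ t²ⁿ / (2n)!
evenEGF : (ℕ → ℚ) → Series
evenEGF a = (λ n → a n * (_/_ (+ 1) ((2 ℕ.* n) !) {{(2 ℕ.* n) !≢0}})) [t²]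

-- quotientCoeffs n lists the coefficients of t²ⁿ, …, t², t⁰ in t / arcsinh t,
-- obtained by long division (the leading coefficient of arcsinh is 1).
quotientCoeffs : ∀ n → Vec ℚ (suc n)
quotientCoeffs zero    = 1ℚ ∷ []
quotientCoeffs (suc n) =
  - (∑[ i ≤ n ] (arcsinhCoeff (suc (toℕ i)) * lookup (quotientCoeffs n) i))
    ∷ quotientCoeffs n

-- 𝔠 n is the number ℭ₂ₙ, characterised by arcsinh-⊛-𝔠 below.
𝔠 : ℕ → ℚ
𝔠 n = head (quotientCoeffs n) * fromℕ ((2 ℕ.* n) !)

quotientCoeff : Series
quotientCoeff = head ∘ quotientCoeffs

lookup-quotientCoeffs : ∀ n (i : Fin (suc n)) →
                        lookup (quotientCoeffs n) i ≡ quotientCoeff (n ∸ toℕ i)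
lookup-quotientCoeffs zero    zero    = refl
lookup-quotientCoeffs (suc n) zero    = refl
lookup-quotientCoeffs (suc n) (suc i) = lookup-quotientCoeffs n i

⊛-congʳ : ∀ f {g h : Series} → (∀ n → g n ≡ h n) → ∀ n → (f ⊛ g) n ≡ (f ⊛ h) n
⊛-congʳ f g≗h n = sum-cong-≗ {suc n} λ i → cong (f (toℕ i) *_) (g≗h (n ∸ toℕ i))

[t²]-cong : ∀ {f g : Series} → (∀ n → f n ≡ g n) → ∀ n → (f [t²]) n ≡ (g [t²]) n
[t²]-cong f≗g zero          = f≗g zero
[t²]-cong f≗g (suc zero)    = refl
[t²]-cong f≗g (suc (suc n)) = [t²]-cong (f≗g ∘ suc) n

[t²]-linear : ∀ a (f g : Series) n →
              a * (f [t²]) n + (g [t²]) n ≡ ((λ k → a * f k + g k) [t²]) n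
[t²]-linear a f g zero          = refl
[t²]-linear a f g (suc zero)    = trans (+-identityʳ _) (*-zeroʳ a)
[t²]-linear a f g (suc (suc n)) = [t²]-linear a (f ∘ suc) (g ∘ suc) n

0*x+y : ∀ x y → 0ℚ * x + y ≡ y
0*x+y x y = trans (cong (λ z → z + y) (*-zeroˡ x)) (+-identityˡ y)

[t²]-⊛ : ∀ f g n → ((f [t²]) ⊛ (g [t²])) n ≡ ((f ⊛ g) [t²]) n
[t²]-⊛ f g zero       = refl
[t²]-⊛ f g (suc zero) =
  cong₂ _+_ (*-zeroʳ (f 0)) (0*x+y (g 0) 0ℚ)
[t²]-⊛ f g (suc (suc n)) = begin
  a + (0ℚ * (g [t²]) (suc n) + (((f ∘ suc) [t²]) ⊛ (g [t²])) n)
    ≡⟨ cong (λ x → a + x) (0*x+y ((g [t²]) (suc n)) _) ⟩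
  a + (((f ∘ suc) [t²]) ⊛ (g [t²])) n
    ≡⟨ cong (λ x → a + x) ([t²]-⊛ (f ∘ suc) g n) ⟩
  a + (((f ∘ suc) ⊛ g) [t²]) n
    ≡⟨ [t²]-linear (f 0) (g ∘ suc) ((f ∘ suc) ⊛ g) n ⟩
  (((f ⊛ g) ∘ suc) [t²]) n ∎
  where
  open ≡-Reasoning
  a = f 0 * ((g ∘ suc) [t²]) n

arcsinhCoeff-⊛-quotientCoeff : ∀ n → (arcsinhCoeff ⊛ quotientCoeff) n ≡ one n
arcsinhCoeff-⊛-quotientCoeff zero    = refl
arcsinhCoeff-⊛-quotientCoeff (suc n) =
  trans (cong₂ _+_ (*-identityˡ (quotientCoeff (suc n))) (sum-cong-≗ {suc n} λ i →
          cong (arcsinhCoeff (suc (toℕ i)) *_) (sym (lookup-quotientCoeffs n i))))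
        (+-inverseˡ (∑[ i ≤ n ] (arcsinhCoeff (suc (toℕ i)) * lookup (quotientCoeffs n) i)))

one-[t²] : ∀ n → (one [t²]) n ≡ one n
one-[t²] zero          = refl
one-[t²] (suc zero)    = refl
one-[t²] (suc (suc n)) = zeros n
  where
  zeros : ∀ n → ((one ∘ suc) [t²]) n ≡ 0ℚ
  zeros zero          = refl
  zeros (suc zero)    = refl
  zeros (suc (suc n)) = zeros n

fromℕ*recip : ∀ d .{{_ : ℕ.NonZero d}} → fromℕ d * (+ 1 / d) ≡ 1ℚ
fromℕ*recip d@(suc _) = toℚᵘ-injective (begin
  toℚᵘ (fromℕ d * (+ 1 / d))             ≈⟨ toℚᵘ-homo-* (fromℕ d) (+ 1 / d) ⟩
  toℚᵘ (fromℕ d) ℚᵘ.* toℚᵘ (+ 1 / d)     ≈⟨ ℚᵘ.*-cong (toℚᵘ-fromℚᵘ (+ d ℚᵘ./ 1)) (toℚᵘ-fromℚᵘ (+ 1 ℚᵘ./ d)) ⟩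
  (+ d ℚᵘ./ 1) ℚᵘ.* (+ 1 ℚᵘ./ d)         ≈⟨ ℚᵘ.*-inverseʳ (+ d ℚᵘ./ 1) ⟩
  toℚᵘ 1ℚ                                ∎)
  where open ℚᵘ.≃-Reasoning

𝔠*recip : ∀ n → 𝔠 n * (_/_ (+ 1) ((2 ℕ.* n) !) {{(2 ℕ.* n) !≢0}}) ≡ quotientCoeff n
𝔠*recip n = trans (*-assoc (quotientCoeff n) _ _)
  (trans (cong (quotientCoeff n *_) (fromℕ*recip ((2 ℕ.* n) !) {{(2 ℕ.* n) !≢0}})) (*-identityʳ (quotientCoeff n)))

-- t / arcsinh t = Σₙ 𝔠ₙ t²ⁿ / (2n)!
arcsinh-⊛-𝔠 : ∀ n → (arcsinh ⊛ evenEGF 𝔠) n ≡ t n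
arcsinh-⊛-𝔠 zero    = 0*x+y (evenEGF 𝔠 0) 0ℚ
arcsinh-⊛-𝔠 (suc n) = begin
  0ℚ * evenEGF 𝔠 (suc n) + ((arcsinhCoeff [t²]) ⊛ evenEGF 𝔠) n
    ≡⟨ 0*x+y (evenEGF 𝔠 (suc n)) _ ⟩
  ((arcsinhCoeff [t²]) ⊛ evenEGF 𝔠) n
    ≡⟨ ⊛-congʳ (arcsinhCoeff [t²]) ([t²]-cong 𝔠*recip) n ⟩
  ((arcsinhCoeff [t²]) ⊛ (quotientCoeff [t²])) n
    ≡⟨ [t²]-⊛ arcsinhCoeff quotientCoeff n ⟩
  ((arcsinhCoeff ⊛ quotientCoeff) [t²]) n
    ≡⟨ [t²]-cong arcsinhCoeff-⊛-quotientCoeff n ⟩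
  (one [t²]) n
    ≡⟨ one-[t²] n ⟩
  one n ∎
  where open ≡-Reasoning

-- The sum of f over all i₁, …, iₖ ≥ 0 with i₁ + ⋯ + iₖ = n
∑-compositions : (k n : ℕ) → (Vec ℕ k → ℚ) → ℚ
∑-compositions zero    zero    f = f []
∑-compositions zero    (suc n) f = 0ℚ
∑-compositions (suc k) n       f =
  ∑[ i ≤ n ] ∑-compositions k (n ∸ toℕ i) (λ is → f (toℕ i ∷ is))

∏[2_]! : ∀ {k : ℕ} → Vec ℕ k → ℕ
∏[2 []     ]! = 1
∏[2 i ∷ is ]! = (2 ℕ.* i) ! ℕ.* ∏[2 is ]!

∏[2_]!≢0 : ∀ {k : ℕ} (is : Vec ℕ k) → ℕ.NonZero ∏[2 is ]!
∏[2 []     ]!≢0 = _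
∏[2 i ∷ is ]!≢0 = m*n≢0 _ _ {{(2 ℕ.* i) !≢0}} {{∏[2 is ]!≢0}}

multinomial : ∀ {k} → ℕ → Vec ℕ k → ℚ
multinomial n is = _/_ (+ ((2 ℕ.* n) !)) ∏[2 is ]! {{∏[2 is ]!≢0}}

-- (ℭ₂ⱼ₁ + ⋯ + ℭ₂ⱼₖ)ⁿ, where js = j₁ ∷ ⋯ ∷ jₖ ∷ []
𝔠⟨_⟩^_ : ∀ {k : ℕ} → Vec ℕ k → ℕ → ℚ
𝔠⟨_⟩^_ {k} js n = ∑-compositions k n λ is →
  multinomial n is * foldr′ _*_ 1ℚ (zipWith (λ i j → 𝔠 (i ℕ.+ j)) is js)

2ℚ : ℚ
2ℚ = fromℕ 2

-- Used for l ≤ n + 1 only, where suc n ∸ l is n - l + 1; the exponent n - l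
-- is -1 when l = n + 1.
denominator : ℕ → ℕ → ℚ
denominator n l =
  fromℕ 3 * 2ℚ ^ᶻ (+ n ℤ.- + l) * fromℕ ((suc n ∸ l) !) * fromℕ ((2 ℕ.* l) !)

^-pos : ∀ p .{{_ : Positive p}} k → Positive (p ^ k)
^-pos p zero    = _
^-pos p (suc k) = pos*pos⇒pos p (p ^ k) {{^-pos p k}}

2^ᶻ-pos : ∀ z → Positive (2ℚ ^ᶻ z)
2^ᶻ-pos (+ k)    = ^-pos 2ℚ k
2^ᶻ-pos -[1+ k ] = ^-pos (1/ 2ℚ) (suc k)

factorial-pos : ∀ m → Positive (fromℕ (m !))
factorial-pos m = normalize-pos (m !) 1 {{_}} {{m !≢0}}

denominator≢0 : (n l : ℕ) → NonZero (denominator n l)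
denominator≢0 n l = pos⇒nonZero (denominator n l) {{pos₄}}
  where
  2^ = 2ℚ ^ᶻ (+ n ℤ.- + l)
  a! = fromℕ ((suc n ∸ l) !)
  b! = fromℕ ((2 ℕ.* l) !)

  pos₂ : Positive (fromℕ 3 * 2^)
  pos₂ = pos*pos⇒pos (fromℕ 3) 2^ {{2^ᶻ-pos (+ n ℤ.- + l)}}

  pos₃ : Positive (fromℕ 3 * 2^ * a!)
  pos₃ = pos*pos⇒pos (fromℕ 3 * 2^) {{pos₂}} a! {{factorial-pos (suc n ∸ l)}}

  pos₄ : Positive (denominator n l)
  pos₄ = pos*pos⇒pos (fromℕ 3 * 2^ * a!) {{pos₃}} b! {{factorial-pos (2 ℕ.* l)}}

numerator : ℕ → ℕ → ℚ
numerator n l =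
  fromℤ -1ℤ ^ᶻ (N ℤ.- L ℤ.- + 1)
  * fromℤ (+ 2 ℤ.* L ℤ.- + 1)
  * fromℤ (+ 3 ℤ.* N ℤ.* N ℤ.- + 3 ℤ.* N ℤ.* L ℤ.+ + 2 ℤ.* L ℤ.* L
           ℤ.+ + 4 ℤ.* N ℤ.- + 3 ℤ.* L ℤ.+ + 1)
  * [2 N ℤ.- L -1]!!
  where
  N = + n
  L = + l

coefficient : ℕ → ℕ → ℚ
coefficient n l = _÷_ (numerator n l) (denominator n l) {{denominator≢0 n l}}

{-# OPTIONS --safe #-}

-- Work with power series in t standing for the square of the paper's variable,
-- and put θ = t d/dt.  Let a and f be the series of arcsinh(√t)/√t and of its
-- reciprocal, let r = √(1+t), and let γ g = g - 2 θ g.  Since a + 2 θ a = 1/r,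
-- differentiating a f = 1 gives f² = r γ f.  Together with its first two
-- derivatives and (θr)² = r (θr - θ²r), this expresses the product f (4θ² - 2θ) f,
-- whose coefficients are the left-hand side, linearly in f with coefficients in
-- r, θr, θ²r.  The coefficients of r are the binomials C(1/2, k); up to the factor
-- -2 they are the double factorial quotients on the right-hand side, with
-- k = n + 1 - l.
module Submission where

open import Defs
open import Algebra.Bundles using (CommutativeRing)
import Algebra.Construct.Pointwise
import Algebra.Solver.Ring
open import Algebra.Solver.Ring.AlmostCommutativeRing using (_-Raw-AlmostCommutative⟶_; fromCommutativeRing)
open import Data.Fin.Base using (Fin; toℕ)
open import Data.Fin.Properties using (toℕ≤pred[n])
open import Data.Integer.Base as ℤ using (ℤ; +_; -[1+_]; -1ℤ)
import Data.Integer.Properties as ℤ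
open import Data.Maybe.Base as Maybe using (Maybe)
open import Data.Nat.Base as ℕ using (ℕ; zero; suc; _!; _∸_) renaming (_*_ to _*ⁿ_)
import Data.Nat.Properties as ℕ
import Data.Nat.Solver as ℕ
open import Data.Product.Base using (_,_)
open import Data.Rational.Base using (ℚ; 0ℚ; 1ℚ; ½; -½; _+_; _*_; -_; _-_; _/_; 1/_; toℚᵘ; +-*-rawRing)
open import Data.Rational.Properties
open import Data.Rational.Solver using (module +-*-Solver)
import Data.Rational.Unnormalised.Base as ℚᵘ
import Data.Rational.Unnormalised.Properties as ℚᵘ
open import Data.Vec.Base using ([]; _∷_; head; tail; foldr′; zipWith)
open import Function.Base using (_∘_)
open import Level using (0ℓ)
open import Relation.Binary.PropositionalEquality
open import Relation.Nullary.Decidable using (dec⇒maybe)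
open import Algebra.Properties.Group +-0-group using () renaming (∙-cancelʳ to +-cancelʳ)

-- The embeddings of ℤ and ℕ into ℚ

-- `_/_` divides by a gcd, which does not compute on variables. The comparison is made in ℚᵘ, where
-- fractions with denominator 1 can be added directly.
fromℤ-+ : ∀ x y → fromℤ (x ℤ.+ y) ≡ fromℤ x + fromℤ y
fromℤ-+ x y = toℚᵘ-injective (begin
  toℚᵘ (fromℤ (x ℤ.+ y))             ≈⟨ toℚᵘ-fromℚᵘ ((x ℤ.+ y) ℚᵘ./ 1) ⟩
  (x ℤ.+ y) ℚᵘ./ 1                   ≡⟨ cong (ℚᵘ._/ 1) (sym (cong₂ ℤ._+_ (ℤ.*-identityʳ x) (ℤ.*-identityʳ y))) ⟩
  (x ℚᵘ./ 1) ℚᵘ.+ (y ℚᵘ./ 1)         ≈⟨ ℚᵘ.+-cong (toℚᵘ-fromℚᵘ (x ℚᵘ./ 1)) (toℚᵘ-fromℚᵘ (y ℚᵘ./ 1)) ⟨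
  toℚᵘ (fromℤ x) ℚᵘ.+ toℚᵘ (fromℤ y) ≈⟨ toℚᵘ-homo-+ (fromℤ x) (fromℤ y) ⟨
  toℚᵘ (fromℤ x + fromℤ y)           ∎)
  where open ℚᵘ.≃-Reasoning

fromℤ-* : ∀ x y → fromℤ (x ℤ.* y) ≡ fromℤ x * fromℤ y
fromℤ-* x y = toℚᵘ-injective (begin
  toℚᵘ (fromℤ (x ℤ.* y))             ≈⟨ toℚᵘ-fromℚᵘ ((x ℤ.* y) ℚᵘ./ 1) ⟩
  (x ℚᵘ./ 1) ℚᵘ.* (y ℚᵘ./ 1)         ≈⟨ ℚᵘ.*-cong (toℚᵘ-fromℚᵘ (x ℚᵘ./ 1)) (toℚᵘ-fromℚᵘ (y ℚᵘ./ 1)) ⟨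
  toℚᵘ (fromℤ x) ℚᵘ.* toℚᵘ (fromℤ y) ≈⟨ toℚᵘ-homo-* (fromℤ x) (fromℤ y) ⟨
  toℚᵘ (fromℤ x * fromℤ y)           ∎)
  where open ℚᵘ.≃-Reasoning

fromℤ-neg : ∀ x → fromℤ (ℤ.- x) ≡ - fromℤ x
fromℤ-neg x = toℚᵘ-injective (begin
  toℚᵘ (fromℤ (ℤ.- x))  ≈⟨ toℚᵘ-fromℚᵘ ((ℤ.- x) ℚᵘ./ 1) ⟩
  ℚᵘ.- (x ℚᵘ./ 1)       ≈⟨ ℚᵘ.-‿cong (toℚᵘ-fromℚᵘ (x ℚᵘ./ 1)) ⟨
  ℚᵘ.- toℚᵘ (fromℤ x)   ≈⟨ toℚᵘ-homo‿- (fromℤ x) ⟨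
  toℚᵘ (- fromℤ x)      ∎)
  where open ℚᵘ.≃-Reasoning

fromℤ-∸ : ∀ x y → fromℤ (x ℤ.- y) ≡ fromℤ x - fromℤ y
fromℤ-∸ x y = trans (fromℤ-+ x (ℤ.- y)) (cong (λ z → fromℤ x + z) (fromℤ-neg y))

/-fromℕ : ∀ z d .{{_ : ℕ.NonZero d}} → (z / d) * fromℕ d ≡ fromℤ z
/-fromℕ z d@(suc _) = toℚᵘ-injective (begin
  toℚᵘ ((z / d) * fromℕ d)           ≈⟨ toℚᵘ-homo-* (z / d) (fromℕ d) ⟩
  toℚᵘ (z / d) ℚᵘ.* toℚᵘ (fromℕ d)   ≈⟨ ℚᵘ.*-cong (toℚᵘ-fromℚᵘ (z ℚᵘ./ d)) (toℚᵘ-fromℚᵘ (+ d ℚᵘ./ 1)) ⟩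
  (z ℚᵘ./ d) ℚᵘ.* (+ d ℚᵘ./ 1)       ≈⟨ ℚᵘ.*≡* (trans (ℤ.*-identityʳ _) (cong (λ e → z ℤ.* (+ e)) (sym (ℕ.*-identityʳ d)))) ⟩
  z ℚᵘ./ 1                           ≈⟨ toℚᵘ-fromℚᵘ (z ℚᵘ./ 1) ⟨
  toℚᵘ (fromℤ z)                     ∎)
  where open ℚᵘ.≃-Reasoning

fromℕ-+ : ∀ m n → fromℕ (m ℕ.+ n) ≡ fromℕ m + fromℕ n
fromℕ-+ m n = trans (cong fromℤ (ℤ.pos-+ m n)) (fromℤ-+ (+ m) (+ n))

fromℕ-* : ∀ m n → fromℕ (m *ⁿ n) ≡ fromℕ m * fromℕ n
fromℕ-* m n = trans (cong fromℤ (ℤ.pos-* m n)) (fromℤ-* (+ m) (+ n))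

fromℕ-suc : ∀ n → fromℕ (suc n) ≡ 1ℚ + fromℕ n
fromℕ-suc = fromℕ-+ 1

*-cancelʳ-fromℕ : ∀ d .{{_ : ℕ.NonZero d}} {p q} → p * fromℕ d ≡ q * fromℕ d → p ≡ q
*-cancelʳ-fromℕ d {p} {q} eq = begin
  p                         ≡⟨ undo p ⟩
  p * fromℕ d * (+ 1 / d)   ≡⟨ cong (_* (+ 1 / d)) eq ⟩
  q * fromℕ d * (+ 1 / d)   ≡⟨ undo q ⟨
  q                         ∎
  where
  open ≡-Reasoning
  undo : ∀ p → p ≡ p * fromℕ d * (+ 1 / d)
  undo p = sym (trans (*-assoc p (fromℕ d) (+ 1 / d))
    (trans (cong (p *_) (fromℕ*recip d)) (*-identityʳ p)))

*-cancelˡ-fromℕ : ∀ d .{{_ : ℕ.NonZero d}} p q → fromℕ d * p ≡ fromℕ d * q → p ≡ q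
*-cancelˡ-fromℕ d p q eq =
  *-cancelʳ-fromℕ d (trans (*-comm p (fromℕ d)) (trans eq (*-comm (fromℕ d) q)))

-- The ring of power series

infixl 6 _⊕_ _⊖_

_⊕_ : Series → Series → Series
(f ⊕ g) n = f n + g n

neg : Series → Series
neg f n = - f n

_⊖_ : Series → Series → Series
f ⊖ g = f ⊕ neg g

const : ℚ → Series
const a zero    = a
const a (suc _) = 0ℚ

𝟘 : Series
𝟘 _ = 0ℚ

⊛-cong : ∀ {f g h k} → f ≗ g → h ≗ k → f ⊛ h ≗ g ⊛ k
⊛-cong f≗g h≗k n =
  sum-cong-≗ {suc n} λ i → cong₂ _*_ (f≗g (toℕ i)) (h≗k (n ∸ toℕ i))

⊛-distribʳ : ∀ h f g → (f ⊕ g) ⊛ h ≗ f ⊛ h ⊕ g ⊛ h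
⊛-distribʳ h f g n = trans
  (sum-cong-≗ {suc n} λ i → *-distribʳ-+ (h (n ∸ toℕ i)) (f (toℕ i)) (g (toℕ i)))
  (∑-distrib-+ {suc n} (λ i → f (toℕ i) * h (n ∸ toℕ i)) λ i → g (toℕ i) * h (n ∸ toℕ i))

⊛-scaleˡ : ∀ a f g n → ((λ k → a * f k) ⊛ g) n ≡ a * (f ⊛ g) n
⊛-scaleˡ a f g n = sym (trans
  (*-distribˡ-sum {suc n} a (λ i → f (toℕ i) * g (n ∸ toℕ i)))
  (sum-cong-≗ {suc n} λ i → sym (*-assoc a (f (toℕ i)) (g (n ∸ toℕ i)))))

⊛-zeroˡ : ∀ f → 𝟘 ⊛ f ≗ 𝟘
⊛-zeroˡ f zero    = 0*x+y (f 0) 0ℚ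
⊛-zeroˡ f (suc n) = trans (0*x+y (f (suc n)) _) (⊛-zeroˡ f n)

const-⊛ : ∀ a f n → (const a ⊛ f) n ≡ a * f n
const-⊛ a f zero    = +-identityʳ (a * f 0)
const-⊛ a f (suc n) =
  trans (cong (λ z → a * f (suc n) + z) (⊛-zeroˡ f n)) (+-identityʳ (a * f (suc n)))

one≗const : one ≗ const 1ℚ
one≗const zero    = refl
one≗const (suc _) = refl

⊛-identityˡ : ∀ f → one ⊛ f ≗ f
⊛-identityˡ f n = trans (⊛-cong {h = f} one≗const (λ _ → refl) n)
  (trans (const-⊛ 1ℚ f n) (*-identityˡ (f n)))

-- `_⊛_` unfolds at the head of its left factor. Splitting off the term with `g 0` instead is what
-- the induction for commutativity needs.
⊛-suc : ∀ f g n → (f ⊛ g) (suc n) ≡ (f ⊛ (g ∘ suc)) n + f (suc n) * g 0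
⊛-suc f g zero    =
  trans (cong (λ z → f 0 * g 1 + z) (+-identityʳ (f 1 * g 0)))
        (cong (λ z → z + f 1 * g 0) (sym (+-identityʳ (f 0 * g 1))))
⊛-suc f g (suc n) =
  trans (cong (λ z → f 0 * g (suc (suc n)) + z) (⊛-suc (f ∘ suc) g n))
        (sym (+-assoc (f 0 * g (suc (suc n))) (((f ∘ suc) ⊛ (g ∘ suc)) n) _))

⊛-comm : ∀ f g → f ⊛ g ≗ g ⊛ f
⊛-comm f g zero    = cong (λ z → z + 0ℚ) (*-comm (f 0) (g 0))
⊛-comm f g (suc n) = begin
  f 0 * g (suc n) + ((f ∘ suc) ⊛ g) n ≡⟨ cong₂ _+_ (*-comm (f 0) (g (suc n))) (⊛-comm (f ∘ suc) g n) ⟩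
  g (suc n) * f 0 + (g ⊛ (f ∘ suc)) n ≡⟨ +-comm (g (suc n) * f 0) _ ⟩
  (g ⊛ (f ∘ suc)) n + g (suc n) * f 0 ≡⟨ ⊛-suc g f n ⟨
  (g ⊛ f) (suc n)                     ∎
  where open ≡-Reasoning

⊛-assoc : ∀ f g h → (f ⊛ g) ⊛ h ≗ f ⊛ (g ⊛ h)
⊛-assoc f g h zero    =
  solve 3 (λ x y z → (x :* y :+ con 0ℚ) :* z :+ con 0ℚ := x :* (y :* z :+ con 0ℚ) :+ con 0ℚ) refl (f 0) (g 0) (h 0)
  where open +-*-Solver
⊛-assoc f g h (suc n) = begin
  -- By definition the tail of `f ⊛ g` is `(λ k → f 0 * g (suc k)) ⊕ (f ∘ suc) ⊛ g`.
  (f 0 * g 0 + 0ℚ) * h (suc n) + (((λ k → f 0 * g (suc k)) ⊕ (f ∘ suc) ⊛ g) ⊛ h) n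
    ≡⟨ cong (λ z → (f 0 * g 0 + 0ℚ) * h (suc n) + z)
         (trans (⊛-distribʳ h (λ k → f 0 * g (suc k)) ((f ∘ suc) ⊛ g) n)
           (cong₂ _+_ (⊛-scaleˡ (f 0) (g ∘ suc) h n) (⊛-assoc (f ∘ suc) g h n))) ⟩
  (f 0 * g 0 + 0ℚ) * h (suc n) + (f 0 * ((g ∘ suc) ⊛ h) n + ((f ∘ suc) ⊛ (g ⊛ h)) n)
    ≡⟨ solve 5 (λ x y z v w → (x :* y :+ con 0ℚ) :* z :+ (x :* v :+ w) := x :* (y :* z :+ v) :+ w) refl
         (f 0) (g 0) (h (suc n)) (((g ∘ suc) ⊛ h) n) (((f ∘ suc) ⊛ (g ⊛ h)) n) ⟩
  f 0 * (g 0 * h (suc n) + ((g ∘ suc) ⊛ h) n) + ((f ∘ suc) ⊛ (g ⊛ h)) n ∎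
  where
  open ≡-Reasoning
  open +-*-Solver

seriesRing : CommutativeRing 0ℓ 0ℓ
seriesRing = record
  { Carrier = Series ; _≈_ = _≗_ ; _+_ = _⊕_ ; _*_ = _⊛_ ; -_ = neg ; 0# = 𝟘 ; 1# = one
  ; isCommutativeRing = record
    { isRing = record
      { +-isAbelianGroup = Algebra.Construct.Pointwise.isAbelianGroup ℕ +-0-isAbelianGroup
      ; *-cong     = ⊛-cong
      ; *-assoc    = ⊛-assoc
      ; *-identity = ⊛-identityˡ , λ f n → trans (⊛-comm f one n) (⊛-identityˡ f n)
      ; distrib    = distribˡ , ⊛-distribʳ
      }
    ; *-comm = ⊛-comm
    }
  }
  where
  distribˡ : ∀ h f g → h ⊛ (f ⊕ g) ≗ h ⊛ f ⊕ h ⊛ g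
  distribˡ h f g n = trans (⊛-comm h (f ⊕ g) n)
    (trans (⊛-distribʳ h f g n) (cong₂ _+_ (⊛-comm f h n) (⊛-comm g h n)))

-- The solver normalises with coefficients whose equality it can test. Rationals, read as constant
-- series, serve for this, and fractions such as ½ become available.
constants : +-*-rawRing -Raw-AlmostCommutative⟶ fromCommutativeRing seriesRing
constants = record
  { ⟦_⟧    = const
  ; +-homo = λ { a b zero → refl ; a b (suc n) → refl }
  ; *-homo = λ { a b zero → sym (+-identityʳ (a * b))
               ; a b (suc n) → sym (trans (const-⊛ a (const b) (suc n)) (*-zeroʳ a)) }
  ; -‿homo = λ { a zero → refl ; a (suc n) → refl }
  ; 0-homo = λ { zero → refl ; (suc n) → refl }
  ; 1-homo = λ n → sym (one≗const n)
  }

const≟ : ∀ a b → Maybe (const a ≗ const b)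
const≟ a b = Maybe.map (λ { refl n → refl }) (dec⇒maybe (a ≟ b))

module SeriesSolver =
  Algebra.Solver.Ring +-*-rawRing (fromCommutativeRing seriesRing) constants const≟

open CommutativeRing seriesRing using () renaming (trans to ≗-trans; +-cong to ⊕-cong)

-- The derivation θ

θ : Series → Series
θ f n = fromℕ n * f n

θ-cong : ∀ {f g} → f ≗ g → θ f ≗ θ g
θ-cong f≗g n = cong (λ z → fromℕ n * z) (f≗g n)

θ-⊕ : ∀ f g → θ (f ⊕ g) ≗ θ f ⊕ θ g
θ-⊕ f g n = *-distribˡ-+ (fromℕ n) (f n) (g n)

-- On the term with index `i` the factor `n` splits as `i + (n ∸ i)`.
θ-⊛ : ∀ f g → θ (f ⊛ g) ≗ θ f ⊛ g ⊕ f ⊛ θ g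
θ-⊛ f g n = begin
  fromℕ n * (f ⊛ g) n
    ≡⟨ *-distribˡ-sum {suc n} (fromℕ n) (λ i → f (toℕ i) * g (n ∸ toℕ i)) ⟩
  ∑[ i ≤ n ] (fromℕ n * (f (toℕ i) * g (n ∸ toℕ i)))
    ≡⟨ sum-cong-≗ {suc n} term ⟩
  ∑[ i ≤ n ] (θ f (toℕ i) * g (n ∸ toℕ i) + f (toℕ i) * θ g (n ∸ toℕ i))
    ≡⟨ ∑-distrib-+ {suc n} (λ i → θ f (toℕ i) * g (n ∸ toℕ i)) (λ i → f (toℕ i) * θ g (n ∸ toℕ i)) ⟩
  (θ f ⊛ g ⊕ f ⊛ θ g) n ∎
  where
  open ≡-Reasoning
  open +-*-Solver
  term : ∀ (i : Fin (suc n)) → fromℕ n * (f (toℕ i) * g (n ∸ toℕ i)) ≡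
         θ f (toℕ i) * g (n ∸ toℕ i) + f (toℕ i) * θ g (n ∸ toℕ i)
  term i = trans
    (cong (λ z → z * (f (toℕ i) * g (n ∸ toℕ i)))
      (trans (cong fromℕ (sym (ℕ.m+[n∸m]≡n (toℕ≤pred[n] i)))) (fromℕ-+ (toℕ i) (n ∸ toℕ i))))
    (solve 4 (λ a b x y → (a :+ b) :* (x :* y) := a :* x :* y :+ x :* (b :* y)) refl
      (fromℕ (toℕ i)) (fromℕ (n ∸ toℕ i)) (f (toℕ i)) (g (n ∸ toℕ i)))

-- This serves to compute modulo relations: the solver writes one side as the other plus multiples
-- `c ⊛ (f ⊖ g)` of known relations `f ≗ g`, which are then discarded one by one, the last summand
-- first.
drop-⊖ : ∀ {y f g} c → f ≗ g → y ⊕ c ⊛ (f ⊖ g) ≗ y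
drop-⊖ {y} {f} {g} c f≗g = ≗-trans
  (⊕-cong {y} {y} (λ _ → refl) (⊛-cong {c} {c} (λ _ → refl) (⊕-cong {f} {g} f≗g (λ n → refl {x = - g n}))))
  (solve 3 (λ y c g → y :+ c :* (g :- g) := y) (λ _ → refl) y c g)
  where open SeriesSolver

θ-scale : ∀ c f → θ (const c ⊛ f) ≗ const c ⊛ θ f
θ-scale c f n = begin
  fromℕ n * (const c ⊛ f) n  ≡⟨ cong (λ z → fromℕ n * z) (const-⊛ c f n) ⟩
  fromℕ n * (c * f n)        ≡⟨ *-assoc (fromℕ n) c (f n) ⟨
  fromℕ n * c * f n          ≡⟨ cong (λ z → z * f n) (*-comm (fromℕ n) c) ⟩
  c * fromℕ n * f n          ≡⟨ *-assoc c (fromℕ n) (f n) ⟩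
  c * θ f n                  ≡⟨ const-⊛ c (θ f) n ⟨
  (const c ⊛ θ f) n          ∎
  where open ≡-Reasoning

θ-t : θ t ≗ t
θ-t zero          = refl
θ-t (suc zero)    = refl
θ-t (suc (suc n)) = *-zeroʳ (fromℕ (suc (suc n)))

-- Multiplication by 1 + t and the binomial differential equation

t-⊛-suc : ∀ f n → (t ⊛ f) (suc n) ≡ f n
t-⊛-suc f n = trans (0*x+y (f (suc n)) _) (⊛-identityˡ f n)

1+t : Series
1+t = const 1ℚ ⊕ t

1+t-⊛-suc : ∀ f n → (1+t ⊛ f) (suc n) ≡ f (suc n) + f n
1+t-⊛-suc f n = trans (⊛-distribʳ f (const 1ℚ) t (suc n))
  (cong₂ _+_ (trans (const-⊛ 1ℚ f (suc n)) (*-identityˡ (f (suc n)))) (t-⊛-suc f n))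

-- Coefficient `suc n` of the product is `f (suc n) + f n`, so the product determines the
-- coefficients of `f` recursively.
1+t-cancel : ∀ f g → 1+t ⊛ f ≗ 1+t ⊛ g → f ≗ g
1+t-cancel f g eq zero    = trans (sym (at-0 f)) (trans (eq 0) (at-0 g))
  where
  at-0 : ∀ f → (1+t ⊛ f) 0 ≡ f 0
  at-0 f = trans (+-identityʳ (1ℚ * f 0)) (*-identityˡ (f 0))
1+t-cancel f g eq (suc n) = +-cancelʳ (f n) (f (suc n)) (g (suc n)) (begin
  f (suc n) + f n         ≡⟨ 1+t-⊛-suc f n ⟨
  (1+t ⊛ f) (suc n)       ≡⟨ eq (suc n) ⟩
  (1+t ⊛ g) (suc n)       ≡⟨ 1+t-⊛-suc g n ⟩
  g (suc n) + g n         ≡⟨ cong (λ z → g (suc n) + z) (1+t-cancel f g eq n) ⟨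
  g (suc n) + f n         ∎)
  where
  open ≡-Reasoning

-- The differential equation of (1 + t)ᶜ.
IsBinomial : ℚ → Series → Set
IsBinomial c f = 1+t ⊛ θ f ≗ const c ⊛ (t ⊛ f)

-- The hypothesis compares the coefficients of degree `suc n`; in degree 0 both sides vanish.
isBinomial : ∀ c f →
  (∀ n → fromℕ (suc n) * f (suc n) + fromℕ n * f n ≡ c * f n) → IsBinomial c f
isBinomial c f rec zero    =
  solve 2 (λ x y → con 1ℚ :* (con 0ℚ :* x) :+ con 0ℚ := y :* (con 0ℚ :* x :+ con 0ℚ) :+ con 0ℚ) refl (f 0) c
  where open +-*-Solver
isBinomial c f rec (suc n) = begin
  (1+t ⊛ θ f) (suc n)           ≡⟨ 1+t-⊛-suc (θ f) n ⟩
  θ f (suc n) + θ f n           ≡⟨ rec n ⟩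
  c * f n                       ≡⟨ cong (λ z → c * z) (t-⊛-suc f n) ⟨
  c * (t ⊛ f) (suc n)           ≡⟨ const-⊛ c (t ⊛ f) (suc n) ⟨
  (const c ⊛ (t ⊛ f)) (suc n)   ∎
  where open ≡-Reasoning

-- The exponents ½ and -½ cancel, so `1+t ⊛ θ (f ⊛ g)` vanishes. Since `θ` kills only constants, the
-- constant term decides.
binomial-inverse : ∀ f g → IsBinomial ½ f → IsBinomial -½ g → (f ⊛ g) 0 ≡ 1ℚ → f ⊛ g ≗ const 1ℚ
binomial-inverse f g f-ode g-ode f0*g0 = λ { zero → f0*g0 ; (suc n) → positive n }
  where
  open SeriesSolver
  θ[fg]≗0 : θ (f ⊛ g) ≗ const 0ℚ
  θ[fg]≗0 = 1+t-cancel _ _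
    (≗-trans (⊛-cong {1+t} (λ _ → refl) (θ-⊛ f g))
    (≗-trans (solve 5 (λ t f g f₁ g₁ →
         (con 1ℚ :+ t) :* (f₁ :* g :+ f :* g₁) :=
         (con 1ℚ :+ t) :* con 0ℚ
           :+ f :* ((con 1ℚ :+ t) :* g₁ :- con -½ :* (t :* g))
           :+ g :* ((con 1ℚ :+ t) :* f₁ :- con ½ :* (t :* f)))
       (λ _ → refl) t f g (θ f) (θ g))
    (≗-trans (drop-⊖ g f-ode) (drop-⊖ f g-ode))))

  positive : ∀ n → (f ⊛ g) (suc n) ≡ 0ℚ
  positive n = *-cancelˡ-fromℕ (suc n) ((f ⊛ g) (suc n)) 0ℚ
    (trans (θ[fg]≗0 (suc n)) (sym (*-zeroʳ (fromℕ (suc n)))))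

-- Multiplied by 1 + t, both sides become ½ t r (θ r): the left by the equation of `r`, the right by
-- that equation and its derivative `ode′`.
θ-sqrt : ∀ r → IsBinomial ½ r → θ r ⊛ θ r ≗ r ⊛ θ r ⊖ r ⊛ θ (θ r)
θ-sqrt r ode = 1+t-cancel _ _
  (≗-trans (solve 4 (λ t r r₁ r₂ →
      (con 1ℚ :+ t) :* (r₁ :* r₁) :=
      (con 1ℚ :+ t) :* (r :* r₁ :- r :* r₂)
        :+ r₁ :* ((con 1ℚ :+ t) :* r₁ :- con ½ :* (t :* r))
        :+ r :* ((t :* r₁ :+ (con 1ℚ :+ t) :* r₂) :- con ½ :* (t :* r :+ t :* r₁))
        :+ (:- r) :* ((con 1ℚ :+ t) :* r₁ :- con ½ :* (t :* r)))
    (λ _ → refl) t r (θ r) (θ (θ r)))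
  (≗-trans (drop-⊖ (neg r) ode) (≗-trans (drop-⊖ r ode′) (drop-⊖ (θ r) ode))))
  where
  open SeriesSolver
  θ[1+t] : θ 1+t ≗ t
  θ[1+t] zero    = refl
  θ[1+t] (suc n) = trans (cong (λ z → fromℕ (suc n) * z) (+-identityˡ (t (suc n)))) (θ-t (suc n))

  ode′ : t ⊛ θ r ⊕ 1+t ⊛ θ (θ r) ≗ const ½ ⊛ (t ⊛ r ⊕ t ⊛ θ r)
  ode′ n = begin
    (t ⊛ θ r ⊕ 1+t ⊛ θ (θ r)) n
      ≡⟨ cong (λ z → z + (1+t ⊛ θ (θ r)) n) (⊛-cong {h = θ r} θ[1+t] (λ _ → refl) n) ⟨
    (θ 1+t ⊛ θ r ⊕ 1+t ⊛ θ (θ r)) n     ≡⟨ θ-⊛ 1+t (θ r) n ⟨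
    θ (1+t ⊛ θ r) n                     ≡⟨ θ-cong ode n ⟩
    θ (const ½ ⊛ (t ⊛ r)) n             ≡⟨ θ-scale ½ (t ⊛ r) n ⟩
    (const ½ ⊛ θ (t ⊛ r)) n
      ≡⟨ ⊛-cong {const ½} (λ _ → refl) (λ k → trans (θ-⊛ t r k)
           (cong (λ z → z + (t ⊛ θ r) k) (⊛-cong {h = r} θ-t (λ _ → refl) k))) n ⟩
    (const ½ ⊛ (t ⊛ r ⊕ t ⊛ θ r)) n     ∎
    where open ≡-Reasoning

-- The equation f² = r γ f and its derivatives

-- With t = x² this is the operator 1 - x d/dx.
γ : Series → Series
γ f = f ⊖ const 2ℚ ⊛ θ f

θ-γ : ∀ f → θ (γ f) ≗ γ (θ f)
θ-γ f n = begin
  fromℕ n * (f n - (const 2ℚ ⊛ θ f) n)        ≡⟨ *-distribˡ-+ (fromℕ n) (f n) _ ⟩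
  θ f n + fromℕ n * (- (const 2ℚ ⊛ θ f) n)    ≡⟨ cong (λ z → θ f n + z) (neg-distribʳ-* (fromℕ n) _) ⟨
  θ f n - fromℕ n * (const 2ℚ ⊛ θ f) n        ≡⟨ cong (λ z → θ f n - z) (θ-scale 2ℚ (θ f) n) ⟩
  θ f n - (const 2ℚ ⊛ θ (θ f)) n              ∎
  where open ≡-Reasoning

-- From θ (a f) = 0 and a f = 1 follows θ f = - f² (θ a). Hence γ f = f + 2 f² (θ a) = f² (a + 2 θ
-- a), and `r` inverts the last factor.
square-reciprocal : ∀ a f r → a ⊛ f ≗ const 1ℚ → r ⊛ (a ⊕ const 2ℚ ⊛ θ a) ≗ const 1ℚ → f ⊛ f ≗ r ⊛ γ f
square-reciprocal a f r af rs =
  ≗-trans (solve 5 (λ a f r a₁ f₁ →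
      f :* f :=
      r :* (f :- con 2ℚ :* f₁)
        :+ (con 2ℚ :* r :* f) :* ((a₁ :* f :+ a :* f₁) :- con 0ℚ)
        :+ (r :* (f :- con 2ℚ :* f₁)) :* (a :* f :- con 1ℚ)
        :+ (:- (f :* f)) :* (r :* (a :+ con 2ℚ :* a₁) :- con 1ℚ))
    (λ _ → refl) a f r (θ a) (θ f))
  (≗-trans (drop-⊖ (neg (f ⊛ f)) rs) (≗-trans (drop-⊖ (r ⊛ γ f) af) (drop-⊖ (const 2ℚ ⊛ r ⊛ f) θ[af])))
  where
  open SeriesSolver
  θ[af] : θ a ⊛ f ⊕ a ⊛ θ f ≗ const 0ℚ
  θ[af] n = trans (sym (θ-⊛ a f n)) (trans (θ-cong af n) (θ-1 n))
    where
    θ-1 : θ (const 1ℚ) ≗ const 0ℚ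
    θ-1 zero    = refl
    θ-1 (suc n) = *-zeroʳ (fromℕ (suc n))

θ-square : ∀ f g r → f ⊛ f ≗ r ⊛ g → const 2ℚ ⊛ (f ⊛ θ f) ≗ θ r ⊛ g ⊕ r ⊛ θ g
θ-square f g r eq = ≗-trans
  (solve 2 (λ f f₁ → con 2ℚ :* (f :* f₁) := f₁ :* f :+ f :* f₁) (λ _ → refl) f (θ f))
  (λ n → trans (sym (θ-⊛ f f n)) (trans (θ-cong eq n) (θ-⊛ r g n)))
  where open SeriesSolver

θθ-square : ∀ f g r → f ⊛ f ≗ r ⊛ g →
  const 2ℚ ⊛ (θ f ⊛ θ f ⊕ f ⊛ θ (θ f)) ≗ (θ (θ r) ⊛ g ⊕ θ r ⊛ θ g) ⊕ (θ r ⊛ θ g ⊕ r ⊛ θ (θ g))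
θθ-square f g r eq n = begin
  (const 2ℚ ⊛ (θ f ⊛ θ f ⊕ f ⊛ θ (θ f))) n  ≡⟨ ⊛-cong {const 2ℚ} (λ _ → refl) (θ-⊛ f (θ f)) n ⟨
  (const 2ℚ ⊛ θ (f ⊛ θ f)) n                ≡⟨ θ-scale 2ℚ (f ⊛ θ f) n ⟨
  θ (const 2ℚ ⊛ (f ⊛ θ f)) n                ≡⟨ θ-cong (θ-square f g r eq) n ⟩
  θ (θ r ⊛ g ⊕ r ⊛ θ g) n                   ≡⟨ θ-⊕ (θ r ⊛ g) (r ⊛ θ g) n ⟩
  θ (θ r ⊛ g) n + θ (r ⊛ θ g) n             ≡⟨ cong₂ _+_ (θ-⊛ (θ r) g n) (θ-⊛ r (θ g) n) ⟩
  _ ∎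
  where open ≡-Reasoning

-- Expressing the product linearly in f

module _ (f r s : Series) (rs : r ⊛ s ≗ const 1ℚ) (f² : f ⊛ f ≗ r ⊛ γ f)
         (r₁² : θ r ⊛ θ r ≗ r ⊛ θ r ⊖ r ⊛ θ (θ r)) where

  private
    f₁ = θ f
    f₂ = θ f₁
    r₁ = θ r
    r₂ = θ r₁
    g₁ = γ f₁
    g₂ = γ f₂
    open SeriesSolver

    2ff₁ : const 2ℚ ⊛ (f ⊛ f₁) ≗ r₁ ⊛ γ f ⊕ r ⊛ γ f₁
    2ff₁ n = trans (θ-square f (γ f) r f² n)
      (cong (λ z → (r₁ ⊛ γ f) n + z) (⊛-cong {r} (λ _ → refl) (θ-γ f) n))

    θθ-γ : θ (θ (γ f)) ≗ γ (θ (θ f))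
    θθ-γ n = trans (θ-cong (θ-γ f) n) (θ-γ (θ f) n)

    2f₁²+2ff₂ : const 2ℚ ⊛ (f₁ ⊛ f₁ ⊕ f ⊛ f₂) ≗ (r₂ ⊛ γ f ⊕ r₁ ⊛ γ f₁) ⊕ (r₁ ⊛ γ f₁ ⊕ r ⊛ γ f₂)
    2f₁²+2ff₂ n = trans (θθ-square f (γ f) r f² n) (cong₂ _+_
      (cong (λ z → (r₂ ⊛ γ f) n + z) (⊛-cong {r₁} (λ _ → refl) (θ-γ f) n))
      (cong₂ _+_ (⊛-cong {r₁} (λ _ → refl) (θ-γ f) n) (⊛-cong {r} (λ _ → refl) θθ-γ n)))

  -- Multiplied by r, both sides become r₁ f (γ f) modulo the relations; r is a unit.
  ff₂-relation : const 2ℚ ⊛ (f ⊛ f₂) ⊕ f ⊛ f₁ ⊖ const (fromℕ 4) ⊛ (f₁ ⊛ f₁) ≗ r₂ ⊛ γ f ⊖ r₁ ⊛ γ f₁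
  ff₂-relation = ≗-trans
    (solve 7 (λ f f₁ f₂ r r₁ r₂ s →
      let g  = f :- con 2ℚ :* f₁
          g₁ = f₁ :- con 2ℚ :* f₂
          lhs = con 2ℚ :* (f :* f₂) :+ f :* f₁ :- con (fromℕ 4) :* (f₁ :* f₁)
          rhs = r₂ :* g :- r₁ :* g₁
      in
      lhs :=
      rhs :+ (s :* (r₁ :- con 2ℚ :* f₁)) :* (f :* f :- r :* g)
          :+ (s :* (f :- r₁)) :* (con 2ℚ :* (f :* f₁) :- (r₁ :* g :+ r :* g₁))
          :+ (:- (s :* g)) :* (r₁ :* r₁ :- (r :* r₁ :- r :* r₂))
          -- The three summands before this one add up to s r (lhs - rhs); this one replaces r s by
          -- 1.
          :+ (rhs :- lhs) :* (r :* s :- con 1ℚ))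
      (λ _ → refl) f f₁ f₂ r r₁ r₂ s)
    (≗-trans (drop-⊖ ((r₂ ⊛ γ f ⊖ r₁ ⊛ γ f₁)
      ⊖ (const 2ℚ ⊛ (f ⊛ f₂) ⊕ f ⊛ f₁ ⊖ const (fromℕ 4) ⊛ (f₁ ⊛ f₁))) rs)
    (≗-trans (drop-⊖ (neg (s ⊛ γ f)) r₁²)
    (≗-trans (drop-⊖ (s ⊛ (f ⊖ r₁)) 2ff₁) (drop-⊖ (s ⊛ (r₁ ⊖ const 2ℚ ⊛ f₁)) f²))))

  -- The multiples 4, -4 and 2 of `2f₁²+2ff₂`, `2ff₁` and `ff₂-relation` are chosen so that the
  -- square `f₁ ⊛ f₁` cancels. What remains is three times f (4 θ² f - 2 θ f), whence the 3 in the
  -- denominator of the theorem.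
  convolution : const (fromℕ 12) ⊛ (f ⊛ f₂) ⊖ const (fromℕ 6) ⊛ (f ⊛ f₁) ≗
    const (fromℕ 6) ⊛ γ f ⊛ r₂ ⊕ (const (fromℕ 6) ⊛ γ f₁ ⊖ const (fromℕ 4) ⊛ γ f) ⊛ r₁
      ⊕ (const (fromℕ 4) ⊛ γ f₂ ⊖ const (fromℕ 4) ⊛ γ f₁) ⊛ r
  convolution = ≗-trans
    (solve 9 (λ f f₁ f₂ r r₁ r₂ g g₁ g₂ →
      con (fromℕ 12) :* (f :* f₂) :- con (fromℕ 6) :* (f :* f₁) :=
      con (fromℕ 6) :* g :* r₂ :+ (con (fromℕ 6) :* g₁ :- con (fromℕ 4) :* g) :* r₁
        :+ (con (fromℕ 4) :* g₂ :- con (fromℕ 4) :* g₁) :* r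
        :+ con (fromℕ 4) :* (con 2ℚ :* (f₁ :* f₁ :+ f :* f₂) :- ((r₂ :* g :+ r₁ :* g₁) :+ (r₁ :* g₁ :+ r :* g₂)))
        :+ (:- con (fromℕ 4)) :* (con 2ℚ :* (f :* f₁) :- (r₁ :* g :+ r :* g₁))
        :+ con 2ℚ :* ((con 2ℚ :* (f :* f₂) :+ f :* f₁ :- con (fromℕ 4) :* (f₁ :* f₁)) :- (r₂ :* g :- r₁ :* g₁)))
      (λ _ → refl) f f₁ f₂ r r₁ r₂ (γ f) g₁ g₂)
    (≗-trans (drop-⊖ (const 2ℚ) ff₂-relation)
    (≗-trans (drop-⊖ (neg (const (fromℕ 4))) 2ff₁) (drop-⊖ (const (fromℕ 4)) 2f₁²+2ff₂)))

-- The series √(1+t) and 1/√(1+t)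

sqrtCoeff : Series
sqrtCoeff zero    = 1ℚ
sqrtCoeff (suc k) = sqrtCoeff k * (½ - fromℕ k) * (+ 1 / suc k)

sqrtCoeff-suc : ∀ k → fromℕ (suc k) * sqrtCoeff (suc k) ≡ sqrtCoeff k * (½ - fromℕ k)
sqrtCoeff-suc k = begin
  fromℕ (suc k) * (x * (+ 1 / suc k))
    ≡⟨ solve 3 (λ a x r → a :* (x :* r) := a :* r :* x) refl (fromℕ (suc k)) x (+ 1 / suc k) ⟩
  fromℕ (suc k) * (+ 1 / suc k) * x   ≡⟨ cong (_* x) (fromℕ*recip (suc k)) ⟩
  1ℚ * x                              ≡⟨ *-identityˡ x ⟩
  x                                   ∎
  where
  open ≡-Reasoning
  open +-*-Solver
  x = sqrtCoeff k * (½ - fromℕ k)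

sqrt-isBinomial : IsBinomial ½ sqrtCoeff
sqrt-isBinomial = isBinomial ½ sqrtCoeff λ n →
  trans (cong (λ z → z + fromℕ n * sqrtCoeff n) (sqrtCoeff-suc n))
    (solve 2 (λ b n → b :* (con ½ :- n) :+ n :* b := con ½ :* b) refl (sqrtCoeff n) (fromℕ n))
  where open +-*-Solver

[2+2n]! : ∀ n → fromℕ ((2 *ⁿ suc n) !) ≡
  (2ℚ + 2ℚ * fromℕ n) * ((1ℚ + 2ℚ * fromℕ n) * fromℕ ((2 *ⁿ n) !))
[2+2n]! n = begin
  fromℕ ((2 *ⁿ suc n) !)        ≡⟨ cong (λ m → fromℕ (m !)) (ℕ.*-suc 2 n) ⟩
  fromℕ ((2 ℕ.+ m) *ⁿ ((1 ℕ.+ m) *ⁿ (m !)))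
    ≡⟨ trans (fromℕ-* (2 ℕ.+ m) ((1 ℕ.+ m) *ⁿ (m !))) (cong₂ _*_ (linear 2)
         (trans (fromℕ-* (1 ℕ.+ m) (m !)) (cong (_* fromℕ (m !)) (linear 1)))) ⟩
  _ ∎
  where
  open ≡-Reasoning
  m = 2 *ⁿ n
  linear : ∀ c → fromℕ (c ℕ.+ m) ≡ fromℕ c + 2ℚ * fromℕ n
  linear c = trans (fromℕ-+ c m) (cong (λ z → fromℕ c + z) (fromℕ-* 2 n))

-- With t = x² this is the derivative of arcsinh x = x a(x²), where a is the series `arcsinhCoeff`.
invSqrtCoeff : Series
invSqrtCoeff = arcsinhCoeff ⊕ const 2ℚ ⊛ θ arcsinhCoeff

centralDenominator : ℕ → ℕ
centralDenominator n = 4 ℕ.^ n *ⁿ (n ! *ⁿ n !)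

signedFactorial : ℕ → ℚ
signedFactorial n = fromℤ (-1ℤ ℤ.^ n ℤ.* + ((2 *ⁿ n) !))

-- The factor 1 + 2n produced by the derivative cancels the last factor of `arcsinhDenominator n`.
invSqrtCoeff-closed : ∀ n → invSqrtCoeff n * fromℕ (centralDenominator n) ≡ signedFactorial n
invSqrtCoeff-closed n = begin
  (a + (const 2ℚ ⊛ θ arcsinhCoeff) n) * d    ≡⟨ cong (λ z → (a + z) * d) (const-⊛ 2ℚ (θ arcsinhCoeff) n) ⟩
  (a + 2ℚ * (fromℕ n * a)) * d
    ≡⟨ solve 3 (λ a n d → (a :+ con 2ℚ :* (n :* a)) :* d := a :* (d :* (con 1ℚ :+ con 2ℚ :* n)))
         refl a (fromℕ n) d ⟩
  a * (d * (1ℚ + 2ℚ * fromℕ n))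
    ≡⟨ cong (λ z → a * (d * z)) (trans (fromℕ-suc (2 *ⁿ n)) (cong (λ z → 1ℚ + z) (fromℕ-* 2 n))) ⟨
  a * (d * fromℕ (suc (2 *ⁿ n)))             ≡⟨ cong (a *_) (fromℕ-* (centralDenominator n) (suc (2 *ⁿ n))) ⟨
  a * fromℕ (arcsinhDenominator n)
    ≡⟨ /-fromℕ (-1ℤ ℤ.^ n ℤ.* + ((2 *ⁿ n) !)) (arcsinhDenominator n) {{arcsinhDenominator≢0 n}} ⟩
  signedFactorial n                          ∎
  where
  open ≡-Reasoning
  open +-*-Solver
  a = arcsinhCoeff n
  d = fromℕ (centralDenominator n)

signedFactorial-suc : ∀ n → signedFactorial (suc n) ≡
  - ((2ℚ + 2ℚ * fromℕ n) * (1ℚ + 2ℚ * fromℕ n)) * signedFactorial n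
signedFactorial-suc n = begin
  fromℤ (-1ℤ ℤ.* -1ℤ ℤ.^ n ℤ.* + ((2 *ⁿ suc n) !))
    ≡⟨ trans (fromℤ-* (-1ℤ ℤ.* -1ℤ ℤ.^ n) (+ ((2 *ⁿ suc n) !))) (cong₂ _*_ (fromℤ-* -1ℤ (-1ℤ ℤ.^ n)) ([2+2n]! n)) ⟩
  fromℤ -1ℤ * s * (a * (b * fromℕ ((2 *ⁿ n) !)))
    ≡⟨ solve 4 (λ s a b f → con (fromℤ -1ℤ) :* s :* (a :* (b :* f)) := :- (a :* b) :* (s :* f))
         refl s a b (fromℕ ((2 *ⁿ n) !)) ⟩
  - (a * b) * (s * fromℕ ((2 *ⁿ n) !))
    ≡⟨ cong (- (a * b) *_) (fromℤ-* (-1ℤ ℤ.^ n) (+ ((2 *ⁿ n) !))) ⟨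
  - (a * b) * signedFactorial n ∎
  where
  open ≡-Reasoning
  open +-*-Solver
  s = fromℤ (-1ℤ ℤ.^ n)
  a = 2ℚ + 2ℚ * fromℕ n
  b = 1ℚ + 2ℚ * fromℕ n

centralDenominator≢0 : ∀ n → ℕ.NonZero (centralDenominator n)
centralDenominator≢0 n = ℕ.m*n≢0 _ _ {{ℕ.m^n≢0 4 n}} {{ℕ.m*n≢0 _ _ {{n ℕ.!≢0}} {{n ℕ.!≢0}}}}

centralDenominator-suc : ∀ n → centralDenominator (suc n) ≡ suc n *ⁿ (4 *ⁿ suc n *ⁿ centralDenominator n)
centralDenominator-suc n =
  solve 3 (λ p m f → con 4 :* p :* (m :* f :* (m :* f)) := m :* (con 4 :* m :* (p :* (f :* f))))
    refl (4 ℕ.^ n) (suc n) (n !)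
  where open ℕ.+-*-Solver

invSqrt-isBinomial : IsBinomial -½ invSqrtCoeff
invSqrt-isBinomial = isBinomial -½ invSqrtCoeff λ n →
  let d  = centralDenominator n
      N  = fromℕ n
      s  = invSqrtCoeff n
      s′ = invSqrtCoeff (suc n)
      -- The recurrence already carries one factor `suc n`, so `centralDenominator (suc n)` divided
      -- by `suc n` clears all denominators.
      M  = 4 *ⁿ suc n *ⁿ d
      e  = fromℕ (suc n)
      M≡ : fromℕ M ≡ fromℕ 4 * (1ℚ + N) * fromℕ d
      M≡ = trans (fromℕ-* (4 *ⁿ suc n) d)
        (cong (_* fromℕ d) (trans (fromℕ-* 4 (suc n)) (cong (fromℕ 4 *_) (fromℕ-suc n))))
      d′≡ : fromℕ (centralDenominator (suc n)) ≡ e * fromℕ M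
      d′≡ = trans (cong fromℕ (centralDenominator-suc n)) (fromℕ-* (suc n) M)
      P  = signedFactorial n
  in *-cancelʳ-fromℕ M {{ℕ.m*n≢0 (4 *ⁿ suc n) d {{_}} {{centralDenominator≢0 n}}}} (begin
    (e * s′ + N * s) * fromℕ M
      ≡⟨ solve 5 (λ e s′ n s m → (e :* s′ :+ n :* s) :* m := s′ :* (e :* m) :+ n :* s :* m) refl e s′ N s (fromℕ M) ⟩
    s′ * (e * fromℕ M) + N * s * fromℕ M
      ≡⟨ cong₂ _+_ (trans (cong (s′ *_) (sym d′≡)) (trans (invSqrtCoeff-closed (suc n)) (signedFactorial-suc n)))
                   (cong (N * s *_) M≡) ⟩
    - ((2ℚ + 2ℚ * N) * (1ℚ + 2ℚ * N)) * P + N * s * (fromℕ 4 * (1ℚ + N) * fromℕ d)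
      ≡⟨ cong (λ z → - ((2ℚ + 2ℚ * N) * (1ℚ + 2ℚ * N)) * z + N * s * (fromℕ 4 * (1ℚ + N) * fromℕ d))
           (sym (invSqrtCoeff-closed n)) ⟩
    - ((2ℚ + 2ℚ * N) * (1ℚ + 2ℚ * N)) * (s * fromℕ d) + N * s * (fromℕ 4 * (1ℚ + N) * fromℕ d)
      ≡⟨ solve 3 (λ n s d → :- ((con 2ℚ :+ con 2ℚ :* n) :* (con 1ℚ :+ con 2ℚ :* n)) :* (s :* d)
               :+ n :* s :* (con (fromℕ 4) :* (con 1ℚ :+ n) :* d)
             := con -½ :* s :* (con (fromℕ 4) :* (con 1ℚ :+ n) :* d)) refl N s (fromℕ d) ⟩
    -½ * s * (fromℕ 4 * (1ℚ + N) * fromℕ d)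
      ≡⟨ cong (-½ * s *_) M≡ ⟨
    -½ * s * fromℕ M ∎)
  where
  open ≡-Reasoning
  open +-*-Solver

sqrt-⊛-invSqrt : sqrtCoeff ⊛ invSqrtCoeff ≗ const 1ℚ
sqrt-⊛-invSqrt = binomial-inverse sqrtCoeff invSqrtCoeff sqrt-isBinomial invSqrt-isBinomial refl

quotient² : quotientCoeff ⊛ quotientCoeff ≗ sqrtCoeff ⊛ γ quotientCoeff
quotient² = square-reciprocal arcsinhCoeff quotientCoeff sqrtCoeff
  (λ n → trans (arcsinhCoeff-⊛-quotientCoeff n) (one≗const n)) sqrt-⊛-invSqrt

-- Coefficients of the linear expression

γ-coeff : ∀ f n → γ f n ≡ (1ℚ - 2ℚ * fromℕ n) * f n
γ-coeff f n = trans (cong (λ z → f n - z) (const-⊛ 2ℚ (θ f) n))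
  (solve 2 (λ x n → x :- con 2ℚ :* (n :* x) := (con 1ℚ :- con 2ℚ :* n) :* x) refl (f n) (fromℕ n))
  where open +-*-Solver

-- The quadratic factor is 3n² - 3nl + 2l² + 4n - 3l + 1 at n = k + l - 1.
weight : ℚ → ℚ → ℚ
weight k l = 2ℚ * (1ℚ - 2ℚ * l) *
  (fromℕ 3 * (k * k) + fromℕ 3 * (k * l) + 2ℚ * (l * l) - 2ℚ * k - 2ℚ * l)

-- On the term with `f l` and `r k`, `θ` multiplies by `l` or `k` and `γ` by 1 - 2l, so the
-- operators collect into one polynomial in `k` and `l`.
∑-weighted : ∀ f r n →
  (const (fromℕ 6) ⊛ γ f ⊛ θ (θ r) ⊕ (const (fromℕ 6) ⊛ γ (θ f) ⊖ const (fromℕ 4) ⊛ γ f) ⊛ θ r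
    ⊕ (const (fromℕ 4) ⊛ γ (θ (θ f)) ⊖ const (fromℕ 4) ⊛ γ (θ f)) ⊛ r) n
  ≡ ∑[ l ≤ n ] (weight (fromℕ (n ∸ toℕ l)) (fromℕ (toℕ l)) * (f (toℕ l) * r (n ∸ toℕ l)))
∑-weighted f r n = begin
  (x₂ ⊛ θ (θ r) ⊕ x₁ ⊛ θ r ⊕ x₀ ⊛ r) n
    ≡⟨ cong (λ z → z + (x₀ ⊛ r) n) (∑-distrib-+ {suc n}
         (λ i → x₂ (toℕ i) * θ (θ r) (n ∸ toℕ i)) λ i → x₁ (toℕ i) * θ r (n ∸ toℕ i)) ⟨
  _ ≡⟨ ∑-distrib-+ {suc n}
         (λ i → x₂ (toℕ i) * θ (θ r) (n ∸ toℕ i) + x₁ (toℕ i) * θ r (n ∸ toℕ i)) (λ i → x₀ (toℕ i) * r (n ∸ toℕ i)) ⟨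
  _ ≡⟨ sum-cong-≗ {suc n} (λ i → term (toℕ i) (n ∸ toℕ i)) ⟩
  _ ∎
  where
  open ≡-Reasoning
  open +-*-Solver
  x₂ = const (fromℕ 6) ⊛ γ f
  x₁ = const (fromℕ 6) ⊛ γ (θ f) ⊖ const (fromℕ 4) ⊛ γ f
  x₀ = const (fromℕ 4) ⊛ γ (θ (θ f)) ⊖ const (fromℕ 4) ⊛ γ (θ f)
  scaled : ∀ c g l → (const c ⊛ γ g) l ≡ c * ((1ℚ - 2ℚ * fromℕ l) * g l)
  scaled c g l = trans (const-⊛ c (γ g) l) (cong (c *_) (γ-coeff g l))
  term : ∀ l k → x₂ l * θ (θ r) k + x₁ l * θ r k + x₀ l * r k ≡ weight (fromℕ k) (fromℕ l) * (f l * r k)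
  term l k = trans
    (cong₂ _+_ (cong₂ _+_
      (cong (_* θ (θ r) k) (scaled (fromℕ 6) f l))
      (cong (_* θ r k) (cong₂ _-_ (scaled (fromℕ 6) (θ f) l) (scaled (fromℕ 4) f l))))
      (cong (_* r k) (cong₂ _-_ (scaled (fromℕ 4) (θ (θ f)) l) (scaled (fromℕ 4) (θ f) l))))
    (solve 4 (λ k l f r →
      let g = λ f → (con 1ℚ :- con 2ℚ :* l) :* f in
      con (fromℕ 6) :* g f :* (k :* (k :* r))
        :+ (con (fromℕ 6) :* g (l :* f) :- con (fromℕ 4) :* g f) :* (k :* r)
        :+ (con (fromℕ 4) :* g (l :* (l :* f)) :- con (fromℕ 4) :* g (l :* f)) :* r
      := con 2ℚ :* (con 1ℚ :- con 2ℚ :* l) :*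
        (con (fromℕ 3) :* (k :* k) :+ con (fromℕ 3) :* (k :* l) :+ con 2ℚ :* (l :* l)
          :- con 2ℚ :* k :- con 2ℚ :* l) :* (f :* r))
      refl (fromℕ k) (fromℕ l) (f l) (r k))

-- The coefficients of the theorem

-- At `zero` the exponent passes from -1 to 0, between the two clauses of `_^ᶻ_`.
signPower : ∀ m → fromℤ -1ℤ ^ᶻ (+ suc m ℤ.- + 1) ≡ - (fromℤ -1ℤ ^ᶻ (+ m ℤ.- + 1))
signPower zero    = refl
signPower (suc m) = solve 1 (λ s → con (fromℤ -1ℤ) :* s := :- s) refl (fromℤ -1ℤ ^ m)
  where open +-*-Solver

-- This is C(1/2, k) = (-1)^(k-1) (2k-3)!! / (2^k k!), with 2k - 3 = 2z - 1. The case k = 0, which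
-- arises from l = n + 1, rests on the convention (-3)!! = -1.
doubleFactorial-sqrtCoeff : ∀ k → let z = + k ℤ.- + 1 in
  fromℤ -1ℤ ^ᶻ (z ℤ.- + 1) * [2 z -1]!! ≡ - (2ℚ * sqrtCoeff k * (2ℚ ^ᶻ z * fromℕ (k !)))
doubleFactorial-sqrtCoeff zero          = refl
doubleFactorial-sqrtCoeff (suc zero)    = refl
doubleFactorial-sqrtCoeff (suc (suc m)) = begin
  fromℤ -1ℤ ^ᶻ (+ suc m ℤ.- + 1) * fromℕ (suc (2 *ⁿ m) *ⁿ oddDoubleFactorial m)
    ≡⟨ cong₂ _*_ (signPower m) (trans (fromℕ-* (suc (2 *ⁿ m)) (oddDoubleFactorial m))
         (cong (_* o) (trans (fromℕ-suc (2 *ⁿ m)) (cong (λ z → 1ℚ + z) (fromℕ-* 2 m))))) ⟩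
  - σ * ((1ℚ + 2ℚ * M) * o)
    ≡⟨ solve 3 (λ σ m o → :- σ :* ((con 1ℚ :+ con 2ℚ :* m) :* o) := :- (con 1ℚ :+ con 2ℚ :* m) :* (σ :* o))
         refl σ M o ⟩
  - (1ℚ + 2ℚ * M) * (σ * o)
    ≡⟨ cong (- (1ℚ + 2ℚ * M) *_) (doubleFactorial-sqrtCoeff (suc m)) ⟩
  - (1ℚ + 2ℚ * M) * - (2ℚ * b * (p * g))
    -- -(1 + 2m) is twice ½ - (1 + m), the factor in the recurrence of `sqrtCoeff`; the 2 raises the
    -- power of two.
    ≡⟨ solve 4 (λ m b p g → :- (con 1ℚ :+ con 2ℚ :* m) :* (:- (con 2ℚ :* b :* (p :* g)))
         := :- (con 2ℚ :* (b :* (con ½ :- (con 1ℚ :+ m))) :* (con 2ℚ :* p :* g))) refl M b p g ⟩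
  - (2ℚ * (b * (½ - (1ℚ + M))) * (2ℚ * p * g))
    ≡⟨ cong (λ z → - (2ℚ * z * (2ℚ * p * g)))
         (trans (cong (λ z → b * (½ - z)) (sym (fromℕ-suc m))) (sym (sqrtCoeff-suc (suc m)))) ⟩
  - (2ℚ * (e * b′) * (2ℚ * p * g))
    ≡⟨ solve 4 (λ e b p g → :- (con 2ℚ :* (e :* b) :* (con 2ℚ :* p :* g))
         := :- (con 2ℚ :* b :* (con 2ℚ :* p :* (e :* g)))) refl e b′ p g ⟩
  - (2ℚ * b′ * (2ℚ * p * (e * g)))
    ≡⟨ cong (λ z → - (2ℚ * b′ * (2ℚ * p * z))) (fromℕ-* (suc (suc m)) (suc m !)) ⟨
  - (2ℚ * b′ * (2ℚ * p * fromℕ (suc (suc m) !))) ∎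
  where
  open ≡-Reasoning
  open +-*-Solver
  σ = fromℤ -1ℤ ^ᶻ (+ m ℤ.- + 1)
  M = fromℕ m
  o = fromℕ (oddDoubleFactorial m)
  b = sqrtCoeff (suc m)
  b′ = sqrtCoeff (suc (suc m))
  p = 2ℚ ^ m
  g = fromℕ (suc m !)
  e = fromℕ (suc (suc m))

numerator-polynomial : ∀ n l → let N = fromℕ n; L = fromℕ l in
  fromℤ (+ 3 ℤ.* + n ℤ.* + n ℤ.- + 3 ℤ.* + n ℤ.* + l ℤ.+ + 2 ℤ.* + l ℤ.* + l
         ℤ.+ + 4 ℤ.* + n ℤ.- + 3 ℤ.* + l ℤ.+ + 1)
  ≡ fromℕ 3 * N * N - fromℕ 3 * N * L + 2ℚ * L * L + fromℕ 4 * N - fromℕ 3 * L + 1ℚ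
numerator-polynomial n l =
  trans (fromℤ-+ (a ℤ.- b ℤ.+ c ℤ.+ d ℤ.- e) (+ 1)) (cong (λ z → z + 1ℚ)
  (trans (fromℤ-∸ (a ℤ.- b ℤ.+ c ℤ.+ d) e) (cong₂ _-_
  (trans (fromℤ-+ (a ℤ.- b ℤ.+ c) d) (cong₂ _+_
  (trans (fromℤ-+ (a ℤ.- b) c) (cong₂ _+_
  (trans (fromℤ-∸ a b) (cong₂ _-_ (cubic (+ 3) (+ n) (+ n)) (cubic (+ 3) (+ n) (+ l))))
  (cubic (+ 2) (+ l) (+ l)))) (fromℤ-* (+ 4) (+ n)))) (fromℤ-* (+ 3) (+ l)))))
  where
  a = + 3 ℤ.* + n ℤ.* + n
  b = + 3 ℤ.* + n ℤ.* + l
  c = + 2 ℤ.* + l ℤ.* + l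
  d = + 4 ℤ.* + n
  e = + 3 ℤ.* + l
  cubic : ∀ x y z → fromℤ (x ℤ.* y ℤ.* z) ≡ fromℤ x * fromℤ y * fromℤ z
  cubic x y z = trans (fromℤ-* (x ℤ.* y) z) (cong (_* fromℤ z) (fromℤ-* x y))

-- The difference n - l can be -1, but `suc n ∸ l` is exact for all `l` in the range. This brings
-- the exponents to the form k - 1 of `doubleFactorial-sqrtCoeff`.
n-l≡k-1 : ∀ {n l} → l ℕ.≤ suc n → + n ℤ.- + l ≡ + (suc n ∸ l) ℤ.- + 1
n-l≡k-1 {n} {l} l≤ = begin
  + n ℤ.- + l                  ≡⟨ ℤ.m-n≡m⊖n n l ⟩
  n ℤ.⊖ l                      ≡⟨ ℤ.[1+m]⊖[1+n]≡m⊖n n l ⟨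
  suc n ℤ.⊖ suc l              ≡⟨ cong (λ m → suc n ℤ.⊖ suc m) (ℕ.+-identityʳ l) ⟨
  suc n ℤ.⊖ (suc l ℕ.+ 0)      ≡⟨ ℤ.distribˡ-⊖-+-neg 0 (suc n) l ⟨
  (suc n ℤ.⊖ l) ℤ.+ -[1+ 0 ]   ≡⟨ cong (ℤ._- + 1) (ℤ.⊖-≥ l≤) ⟩
  + (suc n ∸ l) ℤ.- + 1        ∎
  where open ≡-Reasoning

-- The factor -2 from `doubleFactorial-sqrtCoeff` turns 2l - 1 into 2 (1 - 2l); the quadratic factor
-- is rewritten by n = k + l - 1.
numerator-weight : ∀ {n l} → l ℕ.≤ suc n → let k = suc n ∸ l in
  numerator n l ≡ weight (fromℕ k) (fromℕ l) * sqrtCoeff k * (2ℚ ^ᶻ (+ n ℤ.- + l) * fromℕ (k !))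
numerator-weight {n} {l} l≤ = begin
  σ * x * y * o
    ≡⟨ solve 4 (λ σ x y o → σ :* x :* y :* o := x :* y :* (σ :* o)) refl σ x y o ⟩
  x * y * (σ * o)
    ≡⟨ cong₂ _*_ (cong₂ _*_ x≡ (trans (numerator-polynomial n l) (cong cofactor N≡)))
         (subst (λ z → fromℤ -1ℤ ^ᶻ (z ℤ.- + 1) * [2 z -1]!! ≡ - (2ℚ * b * (2ℚ ^ᶻ z * fromℕ (k !))))
           (sym (n-l≡k-1 l≤)) (doubleFactorial-sqrtCoeff k)) ⟩
  (2ℚ * L - 1ℚ) * cofactor (K + L - 1ℚ) * - (2ℚ * b * e)
    ≡⟨ solve 4 (λ k l b e → let n = k :+ l :- con 1ℚ in
         (con 2ℚ :* l :- con 1ℚ) :*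
           (con (fromℕ 3) :* n :* n :- con (fromℕ 3) :* n :* l :+ con 2ℚ :* l :* l
            :+ con (fromℕ 4) :* n :- con (fromℕ 3) :* l :+ con 1ℚ)
           :* (:- (con 2ℚ :* b :* e)) :=
         con 2ℚ :* (con 1ℚ :- con 2ℚ :* l) :*
           (con (fromℕ 3) :* (k :* k) :+ con (fromℕ 3) :* (k :* l) :+ con 2ℚ :* (l :* l)
            :- con 2ℚ :* k :- con 2ℚ :* l) :* b :* e)
         refl K L b e ⟩
  weight K L * b * e ∎
  where
  open ≡-Reasoning
  open +-*-Solver
  k = suc n ∸ l
  K = fromℕ k
  L = fromℕ l
  b = sqrtCoeff k
  e = 2ℚ ^ᶻ (+ n ℤ.- + l) * fromℕ (k !)
  σ = fromℤ -1ℤ ^ᶻ (+ n ℤ.- + l ℤ.- + 1)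
  x = fromℤ (+ 2 ℤ.* + l ℤ.- + 1)
  y = fromℤ (+ 3 ℤ.* + n ℤ.* + n ℤ.- + 3 ℤ.* + n ℤ.* + l ℤ.+ + 2 ℤ.* + l ℤ.* + l
             ℤ.+ + 4 ℤ.* + n ℤ.- + 3 ℤ.* + l ℤ.+ + 1)
  o = [2 + n ℤ.- + l -1]!!

  cofactor : ℚ → ℚ
  cofactor N = fromℕ 3 * N * N - fromℕ 3 * N * L + 2ℚ * L * L + fromℕ 4 * N - fromℕ 3 * L + 1ℚ

  x≡ : x ≡ 2ℚ * L - 1ℚ
  x≡ = trans (fromℤ-∸ (+ 2 ℤ.* + l) (+ 1)) (cong (λ z → z - 1ℚ) (fromℤ-* (+ 2) (+ l)))

  N≡ : fromℕ n ≡ K + L - 1ℚ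
  N≡ = begin
    fromℕ n                    ≡⟨ solve 1 (λ n → n := con 1ℚ :+ n :- con 1ℚ) refl (fromℕ n) ⟩
    1ℚ + fromℕ n - 1ℚ          ≡⟨ cong (λ z → z - 1ℚ) (fromℕ-suc n) ⟨
    fromℕ (suc n) - 1ℚ         ≡⟨ cong (λ m → fromℕ m - 1ℚ) (ℕ.m∸n+n≡m l≤) ⟨
    fromℕ (k ℕ.+ l) - 1ℚ       ≡⟨ cong (λ z → z - 1ℚ) (fromℕ-+ k l) ⟩
    K + L - 1ℚ                 ∎

-- The whole denominator cancels: the 3 is supplied here, the power of two and `(suc n ∸ l) !` by
-- the numerator, and `(2 *ⁿ l) !` by `𝔠 l`.
coefficient-weight : ∀ {n l} → l ℕ.≤ suc n →
  fromℕ 3 * (coefficient n l * 𝔠 l) ≡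
  weight (fromℕ (suc n ∸ l)) (fromℕ l) * (quotientCoeff l * sqrtCoeff (suc n ∸ l))
coefficient-weight {n} {l} l≤ = begin
  fromℕ 3 * (numerator n l * d⁻¹ * (q * f))
    ≡⟨ cong (λ z → fromℕ 3 * (z * d⁻¹ * (q * f))) (numerator-weight l≤) ⟩
  fromℕ 3 * (w * b * (p * g) * d⁻¹ * (q * f))
    ≡⟨ solve 7 (λ w b p g d q f → con (fromℕ 3) :* (w :* b :* (p :* g) :* d :* (q :* f))
         := w :* (q :* b) :* (con (fromℕ 3) :* p :* g :* f :* d)) refl w b p g d⁻¹ q f ⟩
  w * (q * b) * (denominator n l * d⁻¹)
    ≡⟨ cong (w * (q * b) *_) (*-inverseʳ (denominator n l) {{denominator≢0 n l}}) ⟩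
  w * (q * b) * 1ℚ
    ≡⟨ *-identityʳ (w * (q * b)) ⟩
  w * (q * b) ∎
  where
  open ≡-Reasoning
  open +-*-Solver
  w = weight (fromℕ (suc n ∸ l)) (fromℕ l)
  b = sqrtCoeff (suc n ∸ l)
  q = quotientCoeff l
  f = fromℕ ((2 *ⁿ l) !)
  p = 2ℚ ^ᶻ (+ n ℤ.- + l)
  g = fromℕ ((suc n ∸ l) !)
  d⁻¹ = (1/ denominator n l) {{denominator≢0 n l}}

-- This is `convolution` read in degree n + 1, since k + l = n + 1.
∑-coefficient : ∀ n → fromℕ 3 * ∑[ l ≤ suc n ] (coefficient n (toℕ l) * 𝔠 (toℕ l)) ≡
  (const (fromℕ 12) ⊛ (quotientCoeff ⊛ θ (θ quotientCoeff))
    ⊖ const (fromℕ 6) ⊛ (quotientCoeff ⊛ θ quotientCoeff)) (suc n)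
∑-coefficient n = begin
  _ ≡⟨ *-distribˡ-sum {suc (suc n)} (fromℕ 3) (λ l → coefficient n (toℕ l) * 𝔠 (toℕ l)) ⟩
  _ ≡⟨ sum-cong-≗ {suc (suc n)} (λ l → coefficient-weight {n} (toℕ≤pred[n] l)) ⟩
  _ ≡⟨ ∑-weighted quotientCoeff sqrtCoeff (suc n) ⟨
  _ ≡⟨ convolution quotientCoeff sqrtCoeff invSqrtCoeff sqrt-⊛-invSqrt quotient²
         (θ-sqrt sqrtCoeff sqrt-isBinomial) (suc n) ⟨
  _ ∎
  where open ≡-Reasoning

-- The coefficients, in even powers of x, of d²/dx² Σₙ fₙ x²ⁿ
secondDerivative : Series → Series
secondDerivative f j = (2ℚ + 2ℚ * fromℕ j) * (1ℚ + 2ℚ * fromℕ j) * f (suc j)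

-- With t = x², the operator x² d²/dx² is 4 θ² - 2 θ. The factor x² shifts the degree by one, and
-- the term split off by `⊛-suc` vanishes because `g 0` is zero.
⊛-secondDerivative : ∀ f n → fromℕ 3 * (f ⊛ secondDerivative f) n ≡
  (const (fromℕ 12) ⊛ (f ⊛ θ (θ f)) ⊖ const (fromℕ 6) ⊛ (f ⊛ θ f)) (suc n)
⊛-secondDerivative f n = begin
  fromℕ 3 * (f ⊛ secondDerivative f) n
    ≡⟨ cong (fromℕ 3 *_) (⊛-cong {f} (λ _ → refl) shifted n) ⟩
  fromℕ 3 * (f ⊛ (g ∘ suc)) n
    ≡⟨ cong (fromℕ 3 *_) (trans (cong (λ z → (f ⊛ (g ∘ suc)) n + f (suc n) * z) (g-coeff 0))
         (solve 3 (λ x y z → x :+ y :* (con (fromℕ 4) :* (con 0ℚ :* (con 0ℚ :* z)) :- con 2ℚ :* (con 0ℚ :* z)) := x)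
           refl ((f ⊛ (g ∘ suc)) n) (f (suc n)) (f 0))) ⟨
  fromℕ 3 * ((f ⊛ (g ∘ suc)) n + f (suc n) * g 0)
    ≡⟨ cong (fromℕ 3 *_) (⊛-suc f g n) ⟨
  fromℕ 3 * (f ⊛ g) (suc n)
    ≡⟨ const-⊛ (fromℕ 3) (f ⊛ g) (suc n) ⟨
  (const (fromℕ 3) ⊛ (f ⊛ g)) (suc n)
    ≡⟨ S.solve 3 (λ f f₁ f₂ → S.con (fromℕ 3) S.:* (f S.:* (S.con (fromℕ 4) S.:* f₂ S.:- S.con 2ℚ S.:* f₁))
           S.:= S.con (fromℕ 12) S.:* (f S.:* f₂) S.:- S.con (fromℕ 6) S.:* (f S.:* f₁)) (λ _ → refl) f (θ f) (θ (θ f)) (suc n) ⟩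
  _ ∎
  where
  open ≡-Reasoning
  open +-*-Solver
  module S = SeriesSolver
  g = const (fromℕ 4) ⊛ θ (θ f) ⊖ const 2ℚ ⊛ θ f

  g-coeff : ∀ j → g j ≡ fromℕ 4 * θ (θ f) j - 2ℚ * θ f j
  g-coeff j = cong₂ _-_ (const-⊛ (fromℕ 4) (θ (θ f)) j) (const-⊛ 2ℚ (θ f) j)

  shifted : secondDerivative f ≗ g ∘ suc
  shifted j = begin
    (2ℚ + 2ℚ * fromℕ j) * (1ℚ + 2ℚ * fromℕ j) * f (suc j)
      ≡⟨ solve 2 (λ j x → (con 2ℚ :+ con 2ℚ :* j) :* (con 1ℚ :+ con 2ℚ :* j) :* x :=
           let i = con 1ℚ :+ j in con (fromℕ 4) :* (i :* (i :* x)) :- con 2ℚ :* (i :* x)) refl (fromℕ j) (f (suc j)) ⟩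
    fromℕ 4 * ((1ℚ + fromℕ j) * ((1ℚ + fromℕ j) * f (suc j))) - 2ℚ * ((1ℚ + fromℕ j) * f (suc j))
      ≡⟨ cong (λ i → fromℕ 4 * (i * (i * f (suc j))) - 2ℚ * (i * f (suc j))) (fromℕ-suc j) ⟨
    fromℕ 4 * θ (θ f) (suc j) - 2ℚ * θ f (suc j)
      ≡⟨ g-coeff (suc j) ⟨
    g (suc j) ∎

-- The convolution of Cauchy numbers as a Cauchy product

-- The empty composition forces remainder 0, so only the part equal to `n` survives. The induction
-- moves the skipped index into the summand as `suc (head v) ∷ tail v`.
∑-compositions-1 : ∀ n h → ∑-compositions 1 n h ≡ h (n ∷ [])
∑-compositions-1 zero    h = +-identityʳ (h (0 ∷ []))
∑-compositions-1 (suc n) h =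
  trans (+-identityˡ (∑-compositions 1 n λ v → h (suc (head v) ∷ tail v)))
        (∑-compositions-1 n λ v → h (suc (head v) ∷ tail v))

-- The multinomial denominator cancels (2i)! from `𝔠 i` and (2j)! from the (2j + 2)! in `𝔠 (suc j)`;
-- the leftover (2j + 2)(2j + 1) is the factor of the second derivative.
composition-term : ∀ n i j →
  multinomial n (i ∷ j ∷ []) * (𝔠 (i ℕ.+ 0) * (𝔠 (j ℕ.+ 1) * 1ℚ)) ≡
  fromℕ ((2 *ⁿ n) !) * (quotientCoeff i * secondDerivative quotientCoeff j)
composition-term n i j = begin
  m * (𝔠 (i ℕ.+ 0) * (𝔠 (j ℕ.+ 1) * 1ℚ))
    ≡⟨ cong₂ (λ i j → m * (𝔠 i * (𝔠 j * 1ℚ))) (ℕ.+-identityʳ i) (ℕ.+-comm j 1) ⟩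
  m * (q * a * (q′ * fromℕ ((2 *ⁿ suc j) !) * 1ℚ))
    ≡⟨ cong (λ z → m * (q * a * (q′ * z * 1ℚ))) ([2+2n]! j) ⟩
  m * (q * a * (q′ * (x * (y * b)) * 1ℚ))
    ≡⟨ solve 7 (λ m q a q′ x y b → m :* (q :* a :* (q′ :* (x :* (y :* b)) :* con 1ℚ))
         := m :* (a :* (b :* con 1ℚ)) :* (q :* (x :* y :* q′))) refl m q a q′ x y b ⟩
  m * (a * (b * 1ℚ)) * (q * (x * y * q′))
    ≡⟨ cong (λ z → m * z * (q * (x * y * q′)))
         (trans (fromℕ-* ((2 *ⁿ i) !) ((2 *ⁿ j) ! *ⁿ 1)) (cong (a *_) (fromℕ-* ((2 *ⁿ j) !) 1))) ⟨
  m * fromℕ ∏[2 i ∷ j ∷ [] ]! * (q * (x * y * q′))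
    ≡⟨ cong (_* (q * (x * y * q′)))
         (/-fromℕ (+ ((2 *ⁿ n) !)) ∏[2 i ∷ j ∷ [] ]! {{∏[2 i ∷ j ∷ [] ]!≢0}}) ⟩
  fromℕ ((2 *ⁿ n) !) * (q * (x * y * q′)) ∎
  where
  open ≡-Reasoning
  open +-*-Solver
  m = multinomial n (i ∷ j ∷ [])
  q = quotientCoeff i
  q′ = quotientCoeff (suc j)
  a = fromℕ ((2 *ⁿ i) !)
  b = fromℕ ((2 *ⁿ j) !)
  x = 2ℚ + 2ℚ * fromℕ j
  y = 1ℚ + 2ℚ * fromℕ j

𝔠⟨0,1⟩ : ∀ n → 𝔠⟨ 0 ∷ 1 ∷ [] ⟩^ n ≡
  fromℕ ((2 *ⁿ n) !) * (quotientCoeff ⊛ secondDerivative quotientCoeff) n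
𝔠⟨0,1⟩ n = trans
  (sum-cong-≗ {suc n} λ i → trans
    (∑-compositions-1 (n ∸ toℕ i) λ is → multinomial n (toℕ i ∷ is) *
      foldr′ _*_ 1ℚ (zipWith (λ i j → 𝔠 (i ℕ.+ j)) (toℕ i ∷ is) (0 ∷ 1 ∷ [])))
    (composition-term n (toℕ i) (n ∸ toℕ i)))
  (sym (*-distribˡ-sum {suc n} (fromℕ ((2 *ⁿ n) !))
    (λ i → quotientCoeff (toℕ i) * secondDerivative quotientCoeff (n ∸ toℕ i))))

theorem3 : ∀ (n : ℕ) →
    𝔠⟨ 0 ∷ 1 ∷ [] ⟩^ n
    ≡ fromℕ ((2 *ⁿ n) !) * (∑[ l ≤ suc n ] (coefficient n (toℕ l) * 𝔠 (toℕ l)))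
theorem3 n = trans (𝔠⟨0,1⟩ n) (cong (fromℕ ((2 *ⁿ n) !) *_)
  -- Both sides are compared after multiplication by 3, which clears the constant in `denominator`.
  (*-cancelˡ-fromℕ 3 ((quotientCoeff ⊛ secondDerivative quotientCoeff) n)
    (∑[ l ≤ suc n ] (coefficient n (toℕ l) * 𝔠 (toℕ l)))
    (trans (⊛-secondDerivative quotientCoeff n) (sym (∑-coefficient n)))))
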